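{- If $n\equiv 0 \pmod 4$, then for every $G\in\mathcal{G}_n$ there is a path in $\mathcal{G}_n^*$ from $G$ to some $H\in\mathcal{K}_n$.
   Context: $\mathcal{G}_n$ is the set of simple 3-regular graphs on vertex set $[n]$. A make move ${\tt make}(yxvwz)$ applies to $G=(V,E)$ when $y,x,v,w,z$ are distinct, $yx,xv,vw,wz\in E$ and $xw,yz\notin E$, and replaces $E$ by $(E\setminus\{xy,wz\})\cup\{xw,yz\}$. A break move ${\tt break}(vxw,yz)$ applies when $vxwv$ is a triangle, $yz\in E$, $\{y,z\}\cap\{v,x,w\}=\emptyset$ and $xy,wz\notin E$, and replaces $E$ by $(E\setminus\{xw,yz\})\cup\{xy,wz\}$. $\mathcal{G}_n^*$ is the graph with vertex set $\mathcal{G}_n$ in which $G,G'$ are adjacent iff some make or break move takes $G$ to $G'$. $\mathcal{K}_n$ is the set of graphs in $\mathcal{G}_n$ consisting of $n/4$ connected components each isomorphic to $K_4$. -}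

module Defs where

open import Data.Nat using (ℕ; zero; suc)
open import Data.Fin using (Fin)
open import Data.Fin.Properties using (_≟_)
open import Data.Bool using (Bool; true; false; if_then_else_; _∧_; _∨_)
open import Data.List using (List; []; _∷_; map; allFin)
open import Data.Nat.ListAction using (sum)
open import Data.List.Relation.Unary.Unique.Propositional using (Unique)
open import Data.List.Membership.Propositional using (_∈_)
open import Data.Vec using (Vec; toList)
open import Data.Product using (Σ; _×_; ∃; _,_)
open import Data.Sum using (_⊎_)
open import Relation.Binary.PropositionalEquality using (_≡_; _≢_)
open import Relation.Nullary using (¬_)
open import Relation.Nullary.Decidable using (⌊_⌋)
open import Relation.Binary.Construct.Closure.ReflexiveTransitive using (Star)
open import Function using (_⇔_)

degree : {n : ℕ} → (Fin n → Fin n → Bool) → Fin n → ℕ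
degree {n} adj u = sum (map (λ v → if adj u v then 1 else 0) (allFin n))

record Cubic (n : ℕ) : Set where
  field
    adj    : Fin n → Fin n → Bool
    sym    : ∀ a b → adj a b ≡ adj b a
    irrefl : ∀ a → adj a a ≡ false
    cubic  : ∀ a → degree adj a ≡ 3
open Cubic public

Edge : {n : ℕ} → Cubic n → Fin n → Fin n → Set
Edge G a b = adj G a b ≡ true

isPair : {n : ℕ} → Fin n → Fin n → Fin n → Fin n → Bool
isPair a b x y = (⌊ a ≟ x ⌋ ∧ ⌊ b ≟ y ⌋) ∨ (⌊ a ≟ y ⌋ ∧ ⌊ b ≟ x ⌋)

switchAdj : {n : ℕ} → Cubic n → (p q p' q' s t s' t' : Fin n) → Fin n → Fin n → Bool
switchAdj G p q p' q' s t s' t' a b =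
  if isPair a b s t ∨ isPair a b s' t' then true
  else if isPair a b p q ∨ isPair a b p' q' then false
  else adj G a b

Make : {n : ℕ} → Cubic n → Cubic n → Set
Make {n} G G' = Σ (Fin n) λ y → Σ (Fin n) λ x → Σ (Fin n) λ v → Σ (Fin n) λ w → Σ (Fin n) λ z →
  Unique (y ∷ x ∷ v ∷ w ∷ z ∷ [])
  × Edge G y x × Edge G x v × Edge G v w × Edge G w z
  × ¬ Edge G x w × ¬ Edge G y z
  × (∀ a b → adj G' a b ≡ switchAdj G x y w z x w y z a b)

Break : {n : ℕ} → Cubic n → Cubic n → Set
Break {n} G G' = Σ (Fin n) λ v → Σ (Fin n) λ x → Σ (Fin n) λ w → Σ (Fin n) λ y → Σ (Fin n) λ z →
  Edge G v x × Edge G x w × Edge G w v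
  × Edge G y z
  × y ≢ v × y ≢ x × y ≢ w × z ≢ v × z ≢ x × z ≢ w
  × ¬ Edge G x y × ¬ Edge G w z
  × (∀ a b → adj G' a b ≡ switchAdj G x w y z x y w z a b)

Move : {n : ℕ} → Cubic n → Cubic n → Set
Move G G' = Make G G' ⊎ Break G G'

Adjacent* : {n : ℕ} → Cubic n → Cubic n → Set
Adjacent* G G' = Move G G' ⊎ Move G' G

Connected : {n : ℕ} → Cubic n → Fin n → Fin n → Set
Connected G = Star (Edge G)

K4Union : {n : ℕ} → Cubic n → Set
K4Union {n} G = ∀ u → Σ (Vec (Fin n) 4) λ S →
  Unique (toList S)
  × (∀ v → (Connected G u v ⇔ v ∈ toList S))
  × (∀ v w → v ∈ toList S → w ∈ toList S → v ≢ w → Edge G v w)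

{-# OPTIONS --safe #-}
module Submission where

-- Each step creates a new K₄ component inside the part of the graph not yet made of K₄
-- components. There, at most one make produces a triangle; at most two moves turn a triangle
-- into a diamond (K₄ minus an edge); at most two turn a diamond into a K₄. The only
-- obstruction that stays inside its own component is the prism, whose 6 vertices cannot be all
-- that is left since 4 divides the number of remaining vertices: an edge outside it is then
-- used for a break.
--
-- The case analyses grow a partial description of the graph, which records some vertices and
-- what is known of their adjacency, by asking for a further neighbour of a vertex (it is one
-- of the recorded vertices or a new one) or whether two vertices are adjacent, until known
-- moves lead to the target. A vertex with three known neighbours is known to be non-adjacent
-- to everything else, so the side conditions of the moves are decided by computation.

open import Defs
open import Data.Bool using (Bool; true; false; if_then_else_; _∨_; _∧_)
import Data.Bool.Properties as Bool
open import Data.Fin using (Fin)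
import Data.Fin.Properties as Fin
open import Data.List using (List; []; _∷_; _++_; map; filter; length; allFin; upTo)
open import Data.List.Membership.Propositional using (_∈_; _∉_; find)
open import Data.List.Membership.Propositional.Properties
  using (∈-++⁺ˡ; ∈-++⁺ʳ; ∈-++⁻; ∈-map⁺; ∈-map⁻; ∈-filter⁺; ∈-filter⁻; ∈-∃++; ∈-allFin; ∈-upTo⁺; ∈-upTo⁻)
import Data.List.Membership.DecPropositional as DecMembership
open import Data.List.Properties using (length-map; length-++; length-++-sucʳ; length-tabulate; length-upTo)
open import Data.List.Relation.Binary.Subset.Propositional using (_⊆_)
open import Data.List.Relation.Unary.All as All using (All; []; _∷_)
open import Data.List.Relation.Unary.All.Properties using (¬Any⇒All¬)
open import Data.List.Relation.Unary.AllPairs using ([]; _∷_)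
open import Data.List.Relation.Unary.Any as Any using (here; there)
open import Data.List.Relation.Unary.Unique.Propositional using (Unique)
import Data.List.Relation.Unary.Unique.Propositional.Properties as Unique
import Data.List.Relation.Unary.Unique.DecPropositional as DecUnique
open import Data.Nat using (ℕ; zero; suc; _+_; _%_; _≤_; _<_; z≤n; s≤s; s≤s⁻¹; _<?_)
open import Data.Nat.DivMod using (%-distribˡ-+; m%n%n≡m%n)
open import Data.Nat.ListAction using (sum)
import Data.Nat.Properties as ℕ
open import Data.Product using (Σ; ∃; _×_; _,_; proj₁; proj₂)
open import Data.Sum as Sum using (_⊎_; inj₁; inj₂)
open import Data.Vec using (Vec; []; _∷_; toList)
open import Function using (_∘_; id; _⇔_; mk⇔)
open import Relation.Binary.Construct.Closure.ReflexiveTransitive using (Star; ε; _◅_; _◅◅_)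
open import Relation.Binary.Definitions using (DecidableEquality; Symmetric)
open import Relation.Binary.PropositionalEquality using (_≡_; _≢_; refl; trans; cong; cong₂; subst)
import Relation.Binary.PropositionalEquality as ≡
open import Relation.Nullary using (¬_; Dec; yes; no; does; contradiction)
open import Relation.Nullary.Decidable
  using (True; toWitness; isYes≗does; dec-true; dec-false; decidable-stable; ¬?; _×-dec_; _⊎-dec_)

open DecMembership ℕ._≟_ using () renaming (_∈?_ to _∈ℕ?_)

-- Counting with duplicate-free lists.

module _ {A : Set} where

  unique-⊆⇒length≤ : {xs ys : List A} → Unique xs → xs ⊆ ys → length xs ≤ length ys
  unique-⊆⇒length≤ {[]} _ _ = z≤n
  unique-⊆⇒length≤ {x ∷ xs} (x≢ ∷ u) sub with ∈-∃++ (sub (here refl))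
  ... | as , bs , refl = ℕ.≤-trans (s≤s (unique-⊆⇒length≤ u without))
                           (ℕ.≤-reflexive (≡.sym (length-++-sucʳ as x bs)))
    where
    without : xs ⊆ as ++ bs
    without z∈ with ∈-++⁻ as (sub (there z∈))
    ... | inj₁ z∈as = ∈-++⁺ˡ z∈as
    ... | inj₂ (here refl) = contradiction refl (All.lookup x≢ z∈)
    ... | inj₂ (there z∈bs) = ∈-++⁺ʳ as z∈bs

  ∉-cons : {x : A} {xs : List A} → x ∉ xs → Unique xs → Unique (x ∷ xs)
  ∉-cons x∉ u = ¬Any⇒All¬ _ x∉ ∷ u

  module _ (_≟_ : DecidableEquality A) where
    open DecMembership _≟_ using (_∈?_)

    longer-unique⇒∃∉ : {xs ys : List A} → Unique ys → length xs < length ys →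
                       ∃ λ y → y ∈ ys × y ∉ xs
    longer-unique⇒∃∉ {xs} {ys} u lt with Any.any? (λ y → ¬? (y ∈? xs)) ys
    ... | yes some = find some
    ... | no none = contradiction (unique-⊆⇒length≤ u ys⊆xs) (ℕ.<⇒≱ lt)
      where
      ys⊆xs : ys ⊆ xs
      ys⊆xs y∈ = decidable-stable (_ ∈? xs) (λ y∉ → none (Any.map (λ { refl → y∉ }) y∈))

-- Injectivity is asked on `P` alone because the naming of vertices by numbers is injective just
-- below the size of a state.
unique-map : {A B : Set} (f : A → B) (P : A → Set) →
  (∀ {i j} → P i → P j → f i ≡ f j → i ≡ j) →
  {is : List A} → All P is → Unique is → Unique (map f is)
unique-map f P inj [] [] = []
unique-map {A} f P inj {i ∷ is} (pi ∷ ps) (i≢ ∷ u) =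
  ∉-cons fresh (unique-map f P inj ps u)
  where
  fresh : f i ∉ map f is
  fresh m with ∈-map⁻ f m
  ... | j , j∈ , eq = All.lookup i≢ j∈ (inj pi (All.lookup ps j∈) eq)

-- Neighbourhoods and degrees.

open module FinMembership {n : ℕ} = DecMembership (Fin._≟_ {n}) using (_∈?_)

module _ {n : ℕ} where

  nbrsOf : (Fin n → Bool) → List (Fin n)
  nbrsOf f = filter (λ v → f v Bool.≟ true) (allFin n)

  ∈-nbrsOf : {f : Fin n → Bool} {v : Fin n} → f v ≡ true → v ∈ nbrsOf f
  ∈-nbrsOf e = ∈-filter⁺ _ (∈-allFin _) e

  nbrsOf-∈ : {f : Fin n → Bool} {v : Fin n} → v ∈ nbrsOf f → f v ≡ true
  nbrsOf-∈ {f} m = proj₂ (∈-filter⁻ (λ v → f v Bool.≟ true) {xs = allFin n} m)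

  nbrsOf-unique : (f : Fin n → Bool) → Unique (nbrsOf f)
  nbrsOf-unique f = Unique.filter⁺ (λ v → f v Bool.≟ true) (Unique.allFin⁺ n)

  sum-indicator : {A : Set} (f : A → Bool) (xs : List A) →
    sum (map (λ v → if f v then 1 else 0) xs) ≡ length (filter (λ v → f v Bool.≟ true) xs)
  sum-indicator f [] = refl
  sum-indicator f (x ∷ xs) with f x
  ... | true = cong suc (sum-indicator f xs)
  ... | false = sum-indicator f xs

  -- The first set enlarged by the new element `c` lies inside the second enlarged by `b`. This is
  -- half of an equality: `degree-exchange` applies it twice, the second time with `b` and `c`
  -- swapped.
  exchange-≤ : (f f' : Fin n → Bool) (b c : Fin n) → f c ≡ false → f' c ≡ true →
    (∀ v → v ≢ b → v ≢ c → f v ≡ f' v) → length (nbrsOf f) ≤ length (nbrsOf f')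
  exchange-≤ f f' b c fc f'c agree = s≤s⁻¹ (unique-⊆⇒length≤
    (∉-cons (λ m → contradiction (trans (≡.sym fc) (nbrsOf-∈ {f} m)) λ ()) (nbrsOf-unique f)) sub)
    where
    sub : c ∷ nbrsOf f ⊆ b ∷ nbrsOf f'
    sub (here refl) = there (∈-nbrsOf f'c)
    sub {v} (there m) with v Fin.≟ b
    ... | yes v≡b = here v≡b
    ... | no v≢b = there (∈-nbrsOf (trans (≡.sym (agree v v≢b v≢c)) (nbrsOf-∈ {f} m)))
      where
      v≢c : v ≢ c
      v≢c refl = contradiction (trans (≡.sym fc) (nbrsOf-∈ {f} m)) λ ()

  degree-exchange : (A A' : Fin n → Fin n → Bool) (u b c : Fin n) →
    A u b ≡ true → A u c ≡ false → A' u b ≡ false → A' u c ≡ true →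
    (∀ v → v ≢ b → v ≢ c → A u v ≡ A' u v) → degree A' u ≡ degree A u
  degree-exchange A A' u b c fb fc f'b f'c agree = begin
    degree A' u             ≡⟨ sum-indicator (A' u) (allFin n) ⟩
    length (nbrsOf (A' u))  ≡⟨ ℕ.≤-antisym
      (exchange-≤ (A' u) (A u) c b f'b fb (λ v v≢c v≢b → ≡.sym (agree v v≢b v≢c)))
      (exchange-≤ (A u) (A' u) b c fc f'c agree) ⟩
    length (nbrsOf (A u))   ≡⟨ sum-indicator (A u) (allFin n) ⟨
    degree A u              ∎
    where open ≡.≡-Reasoning

  degree-cong : (A A' : Fin n → Fin n → Bool) (u : Fin n) → (∀ v → A u v ≡ A' u v) →
    degree A' u ≡ degree A u
  degree-cong A A' u eq = begin
    degree A' u             ≡⟨ sum-indicator (A' u) (allFin n) ⟩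
    length (nbrsOf (A' u))  ≡⟨ ℕ.≤-antisym
      (unique-⊆⇒length≤ (nbrsOf-unique (A' u)) (λ m → ∈-nbrsOf (trans (eq _) (nbrsOf-∈ {A' u} m))))
      (unique-⊆⇒length≤ (nbrsOf-unique (A u))
        (λ m → ∈-nbrsOf (trans (≡.sym (eq _)) (nbrsOf-∈ {A u} m)))) ⟩
    length (nbrsOf (A u))   ≡⟨ sum-indicator (A u) (allFin n) ⟨
    degree A u              ∎
    where open ≡.≡-Reasoning

  module _ (G : Cubic n) where

    edge-sym : {a b : Fin n} → Edge G a b → Edge G b a
    edge-sym e = trans (sym G _ _) e

    edge⇒≢ : {a b : Fin n} → Edge G a b → a ≢ b
    edge⇒≢ e refl = contradiction (trans (≡.sym (irrefl G _)) e) λ ()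

    ¬edge⇒false : {a b : Fin n} → ¬ Edge G a b → adj G a b ≡ false
    ¬edge⇒false {a} {b} ¬e with adj G a b
    ... | true = contradiction refl ¬e
    ... | false = refl

    edge? : (a b : Fin n) → Dec (Edge G a b)
    edge? a b = adj G a b Bool.≟ true

    three-nbrs : (u : Fin n) → length (nbrsOf (adj G u)) ≡ 3
    three-nbrs u = trans (≡.sym (sum-indicator (adj G u) (allFin n))) (cubic G u)

    unique-nbrs⇒≤3 : {u : Fin n} {xs : List (Fin n)} → Unique xs →
      (∀ {v} → v ∈ xs → Edge G u v) → length xs ≤ 3
    unique-nbrs⇒≤3 {u} un es = subst (_ ≤_) (three-nbrs u)
      (unique-⊆⇒length≤ un (λ m → ∈-nbrsOf (es m)))

    another-nbr : (u : Fin n) {xs : List (Fin n)} → length xs < 3 →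
      ∃ λ v → Edge G u v × v ∉ xs
    another-nbr u lt
      with longer-unique⇒∃∉ Fin._≟_ (nbrsOf-unique (adj G u)) (subst (_ <_) (≡.sym (three-nbrs u)) lt)
    ... | v , v∈ , v∉ = v , nbrsOf-∈ {adj G u} v∈ , v∉

    three-nbrs-complete : {u v : Fin n} {xs : List (Fin n)} → Unique xs → length xs ≡ 3 →
      (∀ {v} → v ∈ xs → Edge G u v) → Edge G u v → v ∈ xs
    three-nbrs-complete {u} {v} {xs} un len es e = decidable-stable (v ∈? xs) λ v∉ →
      ℕ.<⇒≱ (subst (_< suc (length xs)) len ℕ.≤-refl)
        (unique-nbrs⇒≤3 (∉-cons v∉ un) λ { (here refl) → e ; (there m) → es m })

-- Unordered pairs and the switch of two edges.

SamePair : {A : Set} → A → A → A → A → Set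
SamePair a b x y = (a ≡ x × b ≡ y) ⊎ (a ≡ y × b ≡ x)

samePair? : {A : Set} → DecidableEquality A → (a b x y : A) → Dec (SamePair a b x y)
samePair? _≟_ a b x y = ((a ≟ x) ×-dec (b ≟ y)) ⊎-dec ((a ≟ y) ×-dec (b ≟ x))

samePair-sym : {A : Set} {a b x y : A} → SamePair a b x y → SamePair b a x y
samePair-sym (inj₁ (p , q)) = inj₂ (q , p)
samePair-sym (inj₂ (p , q)) = inj₁ (q , p)

samePair-fromˡ : {A : Set} {v x y : A} → x ≢ y → SamePair x v x y → v ≡ y
samePair-fromˡ _ (inj₁ (_ , v≡y)) = v≡y
samePair-fromˡ x≢y (inj₂ (x≡y , _)) = contradiction x≡y x≢y

samePair-fromʳ : {A : Set} {v x y : A} → x ≢ y → SamePair y v x y → v ≡ x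
samePair-fromʳ x≢y (inj₁ (y≡x , _)) = contradiction (≡.sym y≡x) x≢y
samePair-fromʳ _ (inj₂ (_ , v≡x)) = v≡x

samePair-avoids : {A B : Set} {u v x y : A} → u ≢ x → u ≢ y → SamePair u v x y → B
samePair-avoids u≢x _ (inj₁ (u≡x , _)) = contradiction u≡x u≢x
samePair-avoids _ u≢y (inj₂ (u≡y , _)) = contradiction u≡y u≢y

samePair-irrefl : {A : Set} {a x y : A} → x ≢ y → ¬ SamePair a a x y
samePair-irrefl x≢y (inj₁ (e , e')) = x≢y (trans (≡.sym e) e')
samePair-irrefl x≢y (inj₂ (e , e')) = x≢y (trans (≡.sym e') e)

-- Turns the Boolean test inside `switchAdj` into a decision, which `dec-true` and `dec-false` can
-- evaluate.
isPair≡does : {n : ℕ} (a b x y : Fin n) → isPair a b x y ≡ does (samePair? Fin._≟_ a b x y)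
isPair≡does a b x y = cong₂ _∨_
  (cong₂ _∧_ (isYes≗does (a Fin.≟ x)) (isYes≗does (b Fin.≟ y)))
  (cong₂ _∧_ (isYes≗does (a Fin.≟ y)) (isYes≗does (b Fin.≟ x)))

-- Both moves are this switch, which trades `pq` and `rs` for `pr` and `qs`: a make has `p, q, r, s`
-- equal to `x, y, w, z`, and a break has `x, w, y, z`.
module Switch {n : ℕ} (G : Cubic n) (p q r s : Fin n) where

  Added Removed : Fin n → Fin n → Set
  Added a b = SamePair a b p r ⊎ SamePair a b q s
  Removed a b = SamePair a b p q ⊎ SamePair a b r s

  added? : ∀ a b → Dec (Added a b)
  added? a b = samePair? Fin._≟_ a b p r ⊎-dec samePair? Fin._≟_ a b q s

  removed? : ∀ a b → Dec (Removed a b)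
  removed? a b = samePair? Fin._≟_ a b p q ⊎-dec samePair? Fin._≟_ a b r s

  switched : Fin n → Fin n → Bool
  switched = switchAdj G p q r s p r q s

  switched≡ : ∀ a b → switched a b ≡
    (if does (added? a b) then true else if does (removed? a b) then false else adj G a b)
  switched≡ a b = cong₂ (λ i j → if i then true else if j then false else adj G a b)
    (cong₂ _∨_ (isPair≡does a b p r) (isPair≡does a b q s))
    (cong₂ _∨_ (isPair≡does a b p q) (isPair≡does a b r s))

  added : ∀ {a b} → Added a b → switched a b ≡ true
  added {a} {b} x rewrite switched≡ a b | dec-true (added? a b) x = refl

  removed : ∀ {a b} → ¬ Added a b → Removed a b → switched a b ≡ false
  removed {a} {b} ¬x y
    rewrite switched≡ a b | dec-false (added? a b) ¬x | dec-true (removed? a b) y = refl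

  kept : ∀ {a b} → ¬ Added a b → ¬ Removed a b → switched a b ≡ adj G a b
  kept {a} {b} ¬x ¬y
    rewrite switched≡ a b | dec-false (added? a b) ¬x | dec-false (removed? a b) ¬y = refl

  away : ∀ {a b} → a ∉ p ∷ q ∷ r ∷ s ∷ [] → switched a b ≡ adj G a b
  away {a} {b} a∉ = kept
    (λ { (inj₁ (inj₁ (e , _))) → a∉ (here e)
       ; (inj₁ (inj₂ (e , _))) → a∉ (there (there (here e)))
       ; (inj₂ (inj₁ (e , _))) → a∉ (there (here e))
       ; (inj₂ (inj₂ (e , _))) → a∉ (there (there (there (here e)))) })
    (λ { (inj₁ (inj₁ (e , _))) → a∉ (here e)
       ; (inj₁ (inj₂ (e , _))) → a∉ (there (here e))
       ; (inj₂ (inj₁ (e , _))) → a∉ (there (there (here e)))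
       ; (inj₂ (inj₂ (e , _))) → a∉ (there (there (there (here e)))) })

  switched-sym : ∀ a b → switched a b ≡ switched b a
  switched-sym a b with added? a b
  ... | yes x = trans (added x) (≡.sym (added (Sum.map samePair-sym samePair-sym x)))
  ... | no ¬x with removed? a b
  ...   | yes y = trans (removed ¬x y) (≡.sym (removed (¬x ∘ Sum.map samePair-sym samePair-sym)
                    (Sum.map samePair-sym samePair-sym y)))
  ...   | no ¬y = trans (kept ¬x ¬y) (trans (sym G a b)
                    (≡.sym (kept (¬x ∘ Sum.map samePair-sym samePair-sym)
                      (¬y ∘ Sum.map samePair-sym samePair-sym))))

  -- An endpoint of the switch loses the one neighbour `b` and gains the one neighbour `c`; the last
  -- two hypotheses say that nothing else in its row changes.
  degree-row : (u b c : Fin n) → Edge G u b → ¬ Edge G u c → Removed u b → Added u c →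
    (∀ {v} → Added u v → v ≡ c) → (∀ {v} → Removed u v → v ≡ b) →
    degree switched u ≡ degree (adj G) u
  degree-row u b c ub ¬uc rem add add! rem! =
    degree-exchange (adj G) switched u b c ub (¬edge⇒false G ¬uc)
      -- Added pairs take precedence in `switchAdj`. Were `ub` also added, `b` would be `c`, but
      -- `uc` is not an edge.
      (removed (λ x → ¬uc (subst (Edge G u) (add! x) ub)) rem) (added add)
      (λ v v≢b v≢c → ≡.sym (kept (v≢c ∘ add!) (v≢b ∘ rem!)))

  module _ (p≢r : p ≢ r) (p≢s : p ≢ s) (q≢r : q ≢ r) (q≢s : q ≢ s)
           (pq : Edge G p q) (rs : Edge G r s) (¬pr : ¬ Edge G p r) (¬qs : ¬ Edge G q s) where

    private
      p≢q : p ≢ q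
      p≢q = edge⇒≢ G pq

      r≢s : r ≢ s
      r≢s = edge⇒≢ G rs

    switched-irrefl : ∀ a → switched a a ≡ false
    switched-irrefl a =
      trans (kept Sum.[ samePair-irrefl p≢r , samePair-irrefl q≢s ]
                  Sum.[ samePair-irrefl p≢q , samePair-irrefl r≢s ]) (irrefl G a)

    switched-degree : ∀ a → degree switched a ≡ degree (adj G) a
    switched-degree a with a ∈? (p ∷ q ∷ r ∷ s ∷ [])
    ... | no a∉ = degree-cong (adj G) switched a (λ v → ≡.sym (away a∉))
    ... | yes (here refl) = degree-row p q r pq ¬pr
      (inj₁ (inj₁ (refl , refl))) (inj₁ (inj₁ (refl , refl)))
      Sum.[ samePair-fromˡ p≢r , samePair-avoids p≢q p≢s ]
      Sum.[ samePair-fromˡ p≢q , samePair-avoids p≢r p≢s ]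
    ... | yes (there (here refl)) = degree-row q p s (edge-sym G pq) ¬qs
      (inj₁ (inj₂ (refl , refl))) (inj₂ (inj₁ (refl , refl)))
      Sum.[ samePair-avoids (≡.≢-sym p≢q) q≢r , samePair-fromˡ q≢s ]
      Sum.[ samePair-fromʳ p≢q , samePair-avoids q≢r q≢s ]
    ... | yes (there (there (here refl))) = degree-row r s p rs (¬pr ∘ edge-sym G)
      (inj₂ (inj₁ (refl , refl))) (inj₁ (inj₂ (refl , refl)))
      Sum.[ samePair-fromʳ p≢r , samePair-avoids (≡.≢-sym q≢r) r≢s ]
      Sum.[ samePair-avoids (≡.≢-sym p≢r) (≡.≢-sym q≢r) , samePair-fromˡ r≢s ]
    ... | yes (there (there (there (here refl)))) = degree-row s r q (edge-sym G rs) (¬qs ∘ edge-sym G)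
      (inj₂ (inj₂ (refl , refl))) (inj₂ (inj₂ (refl , refl)))
      Sum.[ samePair-avoids (≡.≢-sym p≢s) (≡.≢-sym r≢s) , samePair-fromʳ q≢s ]
      Sum.[ samePair-avoids (≡.≢-sym p≢s) (≡.≢-sym q≢s) , samePair-fromʳ r≢s ]

    switch : Cubic n
    switch = record
      { adj = switched
      ; sym = switched-sym
      ; irrefl = switched-irrefl
      ; cubic = λ a → trans (switched-degree a) (cubic G a)
      }

-- Partial descriptions of a graph.

-- A partial description of a cubic graph: 0, …, size − 1 name distinct vertices, and each pair is
-- listed in one order only.
record State : Set where
  constructor state
  field
    size : ℕ
    edges nonedges : List (ℕ × ℕ)
open State

incident : List (ℕ × ℕ) → ℕ → List ℕ
incident es i = map proj₂ (filter (λ e → proj₁ e ℕ.≟ i) es) ++ map proj₁ (filter (λ e → proj₂ e ℕ.≟ i) es)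

KnownAdjacent : State → ℕ → ℕ → Set
KnownAdjacent s i j = j ∈ incident (edges s) i

-- Three distinct known neighbours are all the neighbours in a cubic graph. Distinctness is checked
-- since the type of `edges` permits repetitions.
Saturated : State → ℕ → Set
Saturated s i = length (incident (edges s) i) ≡ 3 × Unique (incident (edges s) i)

KnownNonadjacent : State → ℕ → ℕ → Set
KnownNonadjacent s i j = j ∈ incident (nonedges s) i
  ⊎ (Saturated s i × ¬ KnownAdjacent s i j)
  ⊎ (Saturated s j × ¬ KnownAdjacent s j i)

knownAdjacent? : ∀ s i j → Dec (KnownAdjacent s i j)
knownAdjacent? s i j = j ∈ℕ? incident (edges s) i

saturated? : ∀ s i → Dec (Saturated s i)
saturated? s i = (length (incident (edges s) i) ℕ.≟ 3)
  ×-dec DecUnique.unique? ℕ._≟_ (incident (edges s) i)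

knownNonadjacent? : ∀ s i j → Dec (KnownNonadjacent s i j)
knownNonadjacent? s i j = (j ∈ℕ? incident (nonedges s) i)
  ⊎-dec ((saturated? s i ×-dec ¬? (knownAdjacent? s i j))
  ⊎-dec (saturated? s j ×-dec ¬? (knownAdjacent? s j i)))

addEdge addNonedge : ℕ → ℕ → State → State
addEdge i j (state k es ns) = state k ((i , j) ∷ es) ns
addNonedge i j (state k es ns) = state k es ((i , j) ∷ ns)

addVertex : State → State
addVertex (state k es ns) = state (suc k) es ns

differsFrom₂? : (a b c d : ℕ) (e : ℕ × ℕ) →
  Dec (¬ SamePair (proj₁ e) (proj₂ e) a b × ¬ SamePair (proj₁ e) (proj₂ e) c d)
differsFrom₂? a b c d (i , j) = ¬? (samePair? ℕ._≟_ i j a b) ×-dec ¬? (samePair? ℕ._≟_ i j c d)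

switchState : (p q r t : ℕ) → State → State
switchState p q r t (state k es ns) = state k
  ((p , r) ∷ (q , t) ∷ filter (differsFrom₂? p q r t) es)
  ((p , q) ∷ (r , t) ∷ filter (differsFrom₂? p r q t) ns)

-- Embeddings of partial descriptions into a graph.

Holds : {n : ℕ} → ℕ → (ℕ → Fin n) → (Fin n → Fin n → Set) → ℕ × ℕ → Set
Holds k ρ R (i , j) = i < k × j < k × R (ρ i) (ρ j)

incident-holds : {n k : ℕ} {ρ : ℕ → Fin n} {R : Fin n → Fin n → Set} {es : List (ℕ × ℕ)} {i j : ℕ} →
  Symmetric R → All (Holds k ρ R) es → j ∈ incident es i → Holds k ρ R (i , j)
incident-holds {es = es} {i} R-sym h m
  with ∈-++⁻ (map proj₂ (filter (λ e → proj₁ e ℕ.≟ i) es)) m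
... | inj₁ m₁ with ∈-map⁻ proj₂ m₁
...   | _ , m₂ , refl with ∈-filter⁻ (λ e → proj₁ e ℕ.≟ i) m₂
...     | e∈ , refl = All.lookup h e∈
incident-holds {es = es} {i} R-sym h m
    | inj₂ m₁ with ∈-map⁻ proj₁ m₁
...   | _ , m₂ , refl with ∈-filter⁻ (λ e → proj₂ e ℕ.≟ i) m₂
...     | e∈ , refl with All.lookup h e∈
...       | j< , i< , x = i< , j< , R-sym x

-- `place` is a total function; its guarantees concern the names below `size s`.
record Embedding {n : ℕ} (G : Cubic n) (L : List (Fin n)) (s : State) : Set where
  constructor embedding
  field
    place : ℕ → Fin n
    injective : ∀ {i j} → i < size s → j < size s → place i ≡ place j → i ≡ j
    avoids : ∀ {i} → i < size s → place i ∉ L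
    edges-hold : All (Holds (size s) place (Edge G)) (edges s)
    nonedges-hold : All (Holds (size s) place (λ a b → ¬ Edge G a b)) (nonedges s)

module _ {n : ℕ} {G : Cubic n} {L : List (Fin n)} {s : State} (em : Embedding G L s) where
  open Embedding em

  known-edge : ∀ {i j} → KnownAdjacent s i j → Holds (size s) place (Edge G) (i , j)
  known-edge = incident-holds {R = Edge G} (edge-sym G) edges-hold

  place-unique : {is : List ℕ} → All (_< size s) is → Unique is → Unique (map place is)
  place-unique = unique-map place (_< size s) injective

  -- The places of the three known neighbours exhaust the neighbourhood of `place i`, so an adjacent
  -- `place j` is one of them, and by injectivity `j` is a known neighbour.
  saturated-nonedge : ∀ {i j} → j < size s → Saturated s i → ¬ KnownAdjacent s i j →
    ¬ Edge G (place i) (place j)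
  saturated-nonedge {i} {j} j< (len , un) ¬adj e
    with ∈-map⁻ place (three-nbrs-complete G
      (place-unique (All.tabulate (λ m → proj₁ (proj₂ (known-edge m)))) un)
      (trans (length-map place (incident (edges s) i)) len)
      nbr e)
    where
    nbr : ∀ {v} → v ∈ map place (incident (edges s) i) → Edge G (place i) v
    nbr m with ∈-map⁻ place m
    ... | _ , m' , refl = proj₂ (proj₂ (known-edge m'))
  ... | j' , m , eq = ¬adj (subst (KnownAdjacent s i)
                        (≡.sym (injective j< (proj₁ (proj₂ (known-edge m))) eq)) m)

  known-nonedge : ∀ {i j} → i < size s → j < size s → KnownNonadjacent s i j →
    ¬ Edge G (place i) (place j)
  known-nonedge i< j< (inj₁ m) =
    proj₂ (proj₂ (incident-holds {R = λ a b → ¬ Edge G a b} (λ ¬e → ¬e ∘ edge-sym G) nonedges-hold m))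
  known-nonedge i< j< (inj₂ (inj₁ (sat , ¬adj))) = saturated-nonedge j< sat ¬adj
  known-nonedge i< j< (inj₂ (inj₂ (sat , ¬adj))) = saturated-nonedge i< sat ¬adj ∘ edge-sym G

  embed-edge : ∀ {i j} → i < size s → j < size s → Edge G (place i) (place j) →
    Embedding G L (addEdge i j s)
  embed-edge i< j< e = embedding place injective avoids ((i< , j< , e) ∷ edges-hold) nonedges-hold

  embed-nonedge : ∀ {i j} → i < size s → j < size s → ¬ Edge G (place i) (place j) →
    Embedding G L (addNonedge i j s)
  embed-nonedge i< j< ¬e =
    embedding place injective avoids edges-hold ((i< , j< , ¬e) ∷ nonedges-hold)

  placeNext : Fin n → ℕ → Fin n
  placeNext u i = if does (i ℕ.≟ size s) then u else place i

  placeNext-new : ∀ u → placeNext u (size s) ≡ u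
  placeNext-new u rewrite dec-true (size s ℕ.≟ size s) refl = refl

  placeNext-old : ∀ u {i} → i < size s → placeNext u i ≡ place i
  placeNext-old u {i} i< rewrite dec-false (i ℕ.≟ size s) (ℕ.<⇒≢ i<) = refl

  private
    old-or-new : ∀ {i} → i < suc (size s) → i < size s ⊎ i ≡ size s
    old-or-new i< = ℕ.m≤n⇒m<n∨m≡n (s≤s⁻¹ i<)

  embed-vertex : (u : Fin n) → u ∉ L → (∀ {i} → i < size s → place i ≢ u) →
    Embedding G L (addVertex s)
  embed-vertex u u∉L new =
    embedding (placeNext u) inj av (All.map (weaken (Edge G)) edges-hold)
      (All.map (weaken (λ a b → ¬ Edge G a b)) nonedges-hold)
    where
    inj : ∀ {i j} → i < suc (size s) → j < suc (size s) → placeNext u i ≡ placeNext u j → i ≡ j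
    inj i< j< eq with old-or-new i< | old-or-new j<
    ... | inj₁ i<' | inj₁ j<' =
      injective i<' j<' (trans (≡.sym (placeNext-old u i<')) (trans eq (placeNext-old u j<')))
    ... | inj₁ i<' | inj₂ refl = contradiction
      (trans (≡.sym (placeNext-old u i<')) (trans eq (placeNext-new u))) (new i<')
    ... | inj₂ refl | inj₁ j<' = contradiction
      (trans (≡.sym (placeNext-old u j<')) (trans (≡.sym eq) (placeNext-new u))) (new j<')
    ... | inj₂ refl | inj₂ refl = refl

    av : ∀ {i} → i < suc (size s) → placeNext u i ∉ L
    av i< with old-or-new i<
    ... | inj₁ i<' = subst (_∉ L) (≡.sym (placeNext-old u i<')) (avoids i<')
    ... | inj₂ refl = subst (_∉ L) (≡.sym (placeNext-new u)) u∉L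

    weaken : (R : Fin n → Fin n → Set) {e : ℕ × ℕ} →
      Holds (size s) place R e → Holds (suc (size s)) (placeNext u) R e
    -- The bounds carried by `Holds` show that an old record never mentions the new name.
    weaken R (i< , j< , x) = ℕ.m<n⇒m<1+n i< , ℕ.m<n⇒m<1+n j< ,
      ≡.subst₂ R (≡.sym (placeNext-old u i<)) (≡.sym (placeNext-old u j<)) x

  place-samePair : ∀ {i j x y} → i < size s → j < size s → x < size s → y < size s →
    SamePair (place i) (place j) (place x) (place y) → SamePair i j x y
  place-samePair i< j< x< y< =
    Sum.map (λ { (e , e') → injective i< x< e , injective j< y< e' })
            (λ { (e , e') → injective i< y< e , injective j< x< e' })

  module _ {p q r t : ℕ} (p< : p < size s) (q< : q < size s) (r< : r < size s) (t< : t < size s)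
           (p≢r : place p ≢ place r) (p≢t : place p ≢ place t)
           (q≢r : place q ≢ place r) (q≢t : place q ≢ place t)
           (pq : Edge G (place p) (place q)) (rt : Edge G (place r) (place t))
           (¬pr : ¬ Edge G (place p) (place r)) (¬qt : ¬ Edge G (place q) (place t)) where

    open Switch G (place p) (place q) (place r) (place t)

    switchPlaces : Cubic n
    switchPlaces = switch p≢r p≢t q≢r q≢t pq rt ¬pr ¬qt

    -- A record that survives the filters differs from the switched pairs as names, hence by
    -- injectivity as vertices, so the switch cannot falsify it.
    embed-switch : Embedding switchPlaces L (switchState p q r t s)
    embed-switch = embedding place injective avoids
      ((p< , r< , added (inj₁ (inj₁ (refl , refl)))) ∷ (q< , t< , added (inj₂ (inj₁ (refl , refl))))
        ∷ All.tabulate edge)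
      ((p< , q< , still-non not-added₁ (inj₁ (inj₁ (refl , refl))))
        ∷ (r< , t< , still-non not-added₂ (inj₂ (inj₁ (refl , refl)))) ∷ All.tabulate nonedge)
      where
      still-non : ∀ {a b} → ¬ Added a b → Removed a b → ¬ Edge switchPlaces a b
      still-non ¬x y e = contradiction (trans (≡.sym (removed ¬x y)) e) λ ()

      -- A removed pair becomes a non-edge provided that it is not added as well.
      not-added₁ : ¬ Added (place p) (place q)
      not-added₁ (inj₁ x) = q≢r (samePair-fromˡ p≢r x)
      not-added₁ (inj₂ x) = samePair-avoids (edge⇒≢ G pq) p≢t x

      not-added₂ : ¬ Added (place r) (place t)
      not-added₂ (inj₁ x) = p≢t (≡.sym (samePair-fromʳ p≢r x))
      not-added₂ (inj₂ x) = samePair-avoids (≡.≢-sym q≢r) (edge⇒≢ G rt) x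

      edge : ∀ {e} → e ∈ filter (differsFrom₂? p q r t) (edges s) →
        Holds (size s) place (Edge switchPlaces) e
      edge {i , j} m with ∈-filter⁻ (differsFrom₂? p q r t) {xs = edges s} m
      ... | e∈ , ¬pq , ¬rt with All.lookup edges-hold e∈
      ...   | i< , j< , e = i< , j< , lemma
        where
        lemma : Edge switchPlaces (place i) (place j)
        lemma with added? (place i) (place j)
        ... | yes x = added x
        ... | no ¬x = trans (kept ¬x Sum.[ ¬pq ∘ place-samePair i< j< p< q<
                                         , ¬rt ∘ place-samePair i< j< r< t< ]) e

      nonedge : ∀ {e} → e ∈ filter (differsFrom₂? p r q t) (nonedges s) →
        Holds (size s) place (λ a b → ¬ Edge switchPlaces a b) e
      nonedge {i , j} m with ∈-filter⁻ (differsFrom₂? p r q t) {xs = nonedges s} m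
      ... | e∈ , ¬pr' , ¬qt' with All.lookup nonedges-hold e∈
      ...   | i< , j< , ¬e = i< , j< , lemma
        where
        ¬added : ¬ Added (place i) (place j)
        ¬added = Sum.[ ¬pr' ∘ place-samePair i< j< p< r< , ¬qt' ∘ place-samePair i< j< q< t< ]

        lemma : ¬ Edge switchPlaces (place i) (place j)
        lemma with removed? (place i) (place j)
        ... | yes y = still-non ¬added y
        ... | no ¬y = ¬e ∘ trans (≡.sym (kept ¬added ¬y))

    switch-unchanged : ∀ {a b} → a ∈ L → adj switchPlaces a b ≡ adj G a b
    switch-unchanged a∈L = away λ
      { (here refl) → avoids p< a∈L
      ; (there (here refl)) → avoids q< a∈L
      ; (there (there (here refl))) → avoids r< a∈L
      ; (there (there (there (here refl)))) → avoids t< a∈L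
      }

-- Reachability that leaves the finished components alone.

record Reserved {n : ℕ} (L : List (Fin n)) : Set where
  field
    n%4 : n % 4 ≡ 0
    unique : Unique L
    length%4 : length L % 4 ≡ 0

-- Together with symmetry of adjacency, this keeps all neighbours of a vertex outside `L` outside
-- `L`.
Closed : {n : ℕ} → Cubic n → List (Fin n) → Set
Closed G L = ∀ {a b} → a ∈ L → Edge G a b → b ∈ L

Unchanged : {n : ℕ} → Cubic n → Cubic n → List (Fin n) → Set
Unchanged G G' L = ∀ {a b} → a ∈ L → adj G' a b ≡ adj G a b

closed-unchanged : {n : ℕ} (G G' : Cubic n) {L : List (Fin n)} →
  Unchanged G G' L → Closed G L → Closed G' L
closed-unchanged _ _ same cl a∈ e = cl a∈ (trans (≡.sym (same a∈)) e)

Reaches : {n : ℕ} → Cubic n → List (Fin n) → State → Set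
Reaches {n} G L t = Σ (Cubic n) λ G' → Star Adjacent* G G' × Unchanged G G' L × Embedding G' L t

-- L plays the role of the K₄ components already built: it is never touched.
record Leads (s t : State) : Set where
  constructor leads
  field
    run : ∀ {n} {G : Cubic n} {L : List (Fin n)} → Reserved L → Closed G L →
      Embedding G L s → Reaches G L t
open Leads

reaches-move : {n : ℕ} {G G' : Cubic n} {L : List (Fin n)} {t : State} →
  Move G G' → Unchanged G G' L → Reaches G' L t → Reaches G L t
reaches-move mv same (H , path , same' , em) =
  H , inj₁ mv ◅ path , (λ a∈ → trans (same' a∈) (same a∈)) , em

-- The second stage runs in the new graph: `Reserved` does not mention the graph, and `Closed`
-- carries over because adjacency on `L` is unchanged.
leads-trans : {s t u : State} → Leads s t → Leads t u → Leads s u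
leads-trans st tu .run {G = G} res cl em with run st res cl em
... | G' , path , same , em' with run tu res (closed-unchanged G G' same cl) em'
...   | H , path' , same' , em″ = H , path ◅◅ path' , (λ a∈ → trans (same' a∈) (same a∈)) , em″

-- The steps of a case analysis.

entry : List ℕ → ℕ → ℕ
-- The default is safe: `Occurs` checks range and distinctness of the entries.
entry [] _ = 0
entry (x ∷ _) zero = x
entry (_ ∷ xs) (suc i) = entry xs i

-- The target is sought as a subgraph, not necessarily induced; hence it must record no non-edges.
Occurs : List ℕ → State → State → Set
Occurs σ s t =
  (∀ {i} → i < size t → entry σ i < size s × (∀ {j} → j < size t → i ≡ j ⊎ entry σ i ≢ entry σ j))
  × All (λ e → proj₁ e < size t × proj₂ e < size t × KnownAdjacent s (entry σ (proj₁ e)) (entry σ (proj₂ e)))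
      (edges t)
  × nonedges t ≡ []

occurs? : ∀ σ s t → Dec (Occurs σ s t)
occurs? σ s t =
  ℕ.allUpTo? (λ i → (entry σ i <? size s) ×-dec
    ℕ.allUpTo? (λ j → (i ℕ.≟ j) ⊎-dec ¬? (entry σ i ℕ.≟ entry σ j)) (size t)) (size t)
  ×-dec All.all? (λ e → (proj₁ e <? size t) ×-dec ((proj₂ e <? size t) ×-dec
    knownAdjacent? s (entry σ (proj₁ e)) (entry σ (proj₂ e)))) (edges t)
  ×-dec empty? (nonedges t)
  where
  empty? : (xs : List (ℕ × ℕ)) → Dec (xs ≡ [])
  empty? [] = yes refl
  empty? (_ ∷ _) = no λ ()

-- The target occurs in the current state, its vertex i as vertex number i of σ.
done : {s t : State} (σ : List ℕ) {_ : True (occurs? σ s t)} → Leads s t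
done {s} {t} σ {occ} .run {G = G} {L} res cl em with toWitness {a? = occurs? σ s t} occ
... | vertices , adjacent , refl = G , ε , (λ _ → refl) , embedding (place ∘ entry σ) inj
  (λ i< → avoids (proj₁ (vertices i<)))
  (All.map (λ (i< , j< , adj) → i< , j< , proj₂ (proj₂ (known-edge em adj))) adjacent) []
  where
  open Embedding em
  inj : ∀ {i j} → i < size t → j < size t → place (entry σ i) ≡ place (entry σ j) → i ≡ j
  inj i< j< eq with proj₂ (vertices i<) j<
  ... | inj₁ i≡j = i≡j
  ... | inj₂ ne = contradiction (injective (proj₁ (vertices i<)) (proj₁ (vertices j<)) eq) ne

split : {s t : State} (i j : ℕ) {_ : True (i <? size s)} {_ : True (j <? size s)} →
  Leads (addEdge i j s) t → Leads (addNonedge i j s) t → Leads s t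
split i j {i<} {j<} adjacent nonadjacent .run {G = G} res cl em
  with edge? G (Embedding.place em i) (Embedding.place em j)
... | yes e = run adjacent res cl (embed-edge em (toWitness i<) (toWitness j<) e)
... | no ¬e = run nonadjacent res cl (embed-nonedge em (toWitness i<) (toWitness j<) ¬e)

candidate? : ∀ s i j → Dec (j ≢ i × ¬ KnownAdjacent s i j × ¬ KnownNonadjacent s i j)
candidate? s i j = ¬? (j ℕ.≟ i) ×-dec (¬? (knownAdjacent? s i j) ×-dec ¬? (knownNonadjacent? s i j))

candidates : State → ℕ → List ℕ
candidates s i = filter (candidate? s i) (upTo (size s))

-- `olds` treats the candidates in increasing order; `new` treats a vertex not yet recorded, which
-- gets the name `size s`. A recorded vertex that is no candidate cannot be the further neighbour.
nbr : {s t : State} (i : ℕ) {_ : True (i <? size s)} {_ : True (length (incident (edges s) i) <? 3)} →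
  All (λ j → Leads (addEdge i j s) t) (candidates s i) →
  Leads (addEdge i (size s) (addVertex s)) t → Leads s t
nbr {s} i {i<} {few} olds new .run {G = G} {L} res cl em
  with another-nbr G (place i) {map place (incident (edges s) i)}
         (subst (_< 3) (≡.sym (length-map place (incident (edges s) i))) (toWitness few))
  where open Embedding em
... | u , e , u∉ with ℕ.anyUpTo? (λ j → Embedding.place em j Fin.≟ u) (size s)
...   | yes (j , j< , refl) = run (All.lookup olds candidate) res cl (embed-edge em (toWitness i<) j< e)
  where
  candidate : j ∈ candidates s i
  candidate = ∈-filter⁺ (candidate? s i) (∈-upTo⁺ j<)
    ( (λ { refl → edge⇒≢ G e refl })
    , (λ adj → u∉ (∈-map⁺ _ adj))
    , (λ non → known-nonedge em (toWitness i<) j< non e) )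
...   | no ¬old = run new res cl
  (embed-edge em' (ℕ.m<n⇒m<1+n (toWitness i<)) ℕ.≤-refl
    (≡.subst₂ (Edge G) (≡.sym (placeNext-old em u (toWitness i<))) (≡.sym (placeNext-new em u)) e))
  where
  em' : Embedding G L (addVertex s)
  -- As `L` is closed, `u` in `L` would force its neighbour `place i` into `L`.
  em' = embed-vertex em u (λ u∈ → Embedding.avoids em (toWitness i<) (cl u∈ (edge-sym G e)))
    (λ j< eq → ¬old (_ , j< , eq))

m%4≢0⇒[m+n]%4≢0 : ∀ m n → m % 4 ≢ 0 → n % 4 ≡ 0 → (m + n) % 4 ≢ 0
m%4≢0⇒[m+n]%4≢0 m n m≢ n≡ eq = m≢ (begin
  m % 4                  ≡⟨ m%n%n≡m%n m 4 ⟨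
  m % 4 % 4              ≡⟨ cong (_% 4) (ℕ.+-identityʳ (m % 4)) ⟨
  (m % 4 + 0) % 4        ≡⟨ cong (λ k → (m % 4 + k) % 4) n≡ ⟨
  (m % 4 + n % 4) % 4    ≡⟨ %-distribˡ-+ m n 4 ⟨
  (m + n) % 4            ≡⟨ eq ⟩
  0                      ∎)
  where open ≡.≡-Reasoning

unique-length≤ : {n : ℕ} {xs : List (Fin n)} → Unique xs → length xs ≤ n
unique-length≤ {n} {xs} u = subst (length xs ≤_) (length-tabulate id)
  (unique-⊆⇒length≤ u (λ _ → ∈-allFin _))

places-unique : {n : ℕ} {G : Cubic n} {L : List (Fin n)} {s : State} (em : Embedding G L s) →
  Unique L → Unique (map (Embedding.place em) (upTo (size s)) ++ L)
places-unique {L = L} {s} em un = Unique.++⁺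
  (place-unique em (All.tabulate ∈-upTo⁻) (Unique.upTo⁺ (size s))) un
  λ { (m , v∈L) → disjoint m v∈L }
  where
  disjoint : ∀ {v} → v ∈ map (Embedding.place em) (upTo (size s)) → v ∉ L
  disjoint m v∈L with ∈-map⁻ (Embedding.place em) m
  ... | _ , i∈ , refl = Embedding.avoids em (∈-upTo⁻ i∈) v∈L

-- Both n and the length of L are divisible by 4, so the known vertices cannot be all that is left.
fresh : {s t : State} {_ : True (¬? (size s % 4 ℕ.≟ 0))} → Leads (addVertex s) t → Leads s t
fresh {s} {_} {size%4} next .run {n} {G} {L} res cl em = continue
  (longer-unique⇒∃∉ Fin._≟_ {xs = used} (Unique.allFin⁺ n)
    (subst (length used <_) (≡.sym (length-tabulate id)) used<n))
  where
  open Embedding em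
  used : List (Fin n)
  used = map place (upTo (size s)) ++ L

  length-used : length used ≡ size s + length L
  length-used = trans (length-++ (map place (upTo (size s))))
    (cong (_+ length L) (trans (length-map place (upTo (size s))) (length-upTo (size s))))

  used<n : length used < n
  used<n = ℕ.≤∧≢⇒< (unique-length≤ (places-unique em (Reserved.unique res))) λ eq →
    m%4≢0⇒[m+n]%4≢0 (size s) (length L) (toWitness size%4) (Reserved.length%4 res)
      (trans (cong (_% 4) (trans (≡.sym length-used) eq)) (Reserved.n%4 res))

  continue : (∃ λ u → u ∈ allFin n × u ∉ used) → Reaches G L _
  continue (u , _ , u∉) = run next res cl (embed-vertex em u
    (λ u∈L → u∉ (∈-++⁺ʳ (map place (upTo (size s))) u∈L))
    (λ i< eq → u∉ (∈-++⁺ˡ (subst (_∈ map place (upTo (size s))) eq (∈-map⁺ place (∈-upTo⁺ i<))))))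

Makeable : State → (y x v w z : ℕ) → Set
Makeable s y x v w z = Unique (y ∷ x ∷ v ∷ w ∷ z ∷ [])
  × KnownAdjacent s y x × KnownAdjacent s x v × KnownAdjacent s v w × KnownAdjacent s w z
  × KnownNonadjacent s x w × KnownNonadjacent s y z

makeable? : ∀ s y x v w z → Dec (Makeable s y x v w z)
makeable? s y x v w z = DecUnique.unique? ℕ._≟_ (y ∷ x ∷ v ∷ w ∷ z ∷ [])
  ×-dec (knownAdjacent? s y x ×-dec (knownAdjacent? s x v ×-dec (knownAdjacent? s v w
  ×-dec (knownAdjacent? s w z ×-dec (knownNonadjacent? s x w ×-dec knownNonadjacent? s y z)))))

make : {s t : State} (y x v w z : ℕ) {_ : True (makeable? s y x v w z)} →
  Leads (switchState x y w z s) t → Leads s t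
make {s} y x v w z {ok} next .run {G = G} res cl em with toWitness {a? = makeable? s y x v w z} ok
... | un , yx , xv , vw , wz , ¬xw , ¬yz
  with known-edge em yx | known-edge em xv | known-edge em vw | known-edge em wz
... | y< , x< , YX | _ , v< , XV | _ , w< , VW | _ , z< , WZ
  with place-unique em (y< ∷ x< ∷ v< ∷ w< ∷ z< ∷ []) un
     | known-nonedge em x< w< ¬xw | known-nonedge em y< z< ¬yz
... | UN@((_ ∷ _ ∷ Y≢W ∷ Y≢Z ∷ []) ∷ (_ ∷ X≢W ∷ X≢Z ∷ []) ∷ _) | ¬XW | ¬YZ =
  -- With the endpoints in the order `x, y, w, z`, the switch unfolds to the very `switchAdj` of
  -- `Make`, whence `refl`.
  reaches-move {G' = H} (inj₁ (_ , _ , _ , _ , _ , UN , YX , XV , VW , WZ , ¬XW , ¬YZ , λ _ _ → refl))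
    same (run next res (closed-unchanged G H same cl)
      (embed-switch em x< y< w< z< X≢W X≢Z Y≢W Y≢Z (edge-sym G YX) WZ ¬XW ¬YZ))
  where
  H = switchPlaces em x< y< w< z< X≢W X≢Z Y≢W Y≢Z (edge-sym G YX) WZ ¬XW ¬YZ
  same : Unchanged G H _
  same = switch-unchanged em x< y< w< z< X≢W X≢Z Y≢W Y≢Z (edge-sym G YX) WZ ¬XW ¬YZ

Breakable : State → (v x w y z : ℕ) → Set
Breakable s v x w y z = Unique (v ∷ x ∷ w ∷ y ∷ z ∷ [])
  × KnownAdjacent s v x × KnownAdjacent s x w × KnownAdjacent s w v × KnownAdjacent s y z
  × KnownNonadjacent s x y × KnownNonadjacent s w z

breakable? : ∀ s v x w y z → Dec (Breakable s v x w y z)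
breakable? s v x w y z = DecUnique.unique? ℕ._≟_ (v ∷ x ∷ w ∷ y ∷ z ∷ [])
  ×-dec (knownAdjacent? s v x ×-dec (knownAdjacent? s x w ×-dec (knownAdjacent? s w v
  ×-dec (knownAdjacent? s y z ×-dec (knownNonadjacent? s x y ×-dec knownNonadjacent? s w z)))))

break : {s t : State} (v x w y z : ℕ) {_ : True (breakable? s v x w y z)} →
  Leads (switchState x w y z s) t → Leads s t
break {s} v x w y z {ok} next .run {G = G} res cl em with toWitness {a? = breakable? s v x w y z} ok
... | un , vx , xw , wv , yz , ¬xy , ¬wz
  with known-edge em vx | known-edge em xw | known-edge em wv | known-edge em yz
... | v< , x< , VX | _ , w< , XW | _ , _ , WV | y< , z< , YZ
  with place-unique em (v< ∷ x< ∷ w< ∷ y< ∷ z< ∷ []) un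
     | known-nonedge em x< y< ¬xy | known-nonedge em w< z< ¬wz
... | (_ ∷ _ ∷ V≢Y ∷ V≢Z ∷ []) ∷ (_ ∷ X≢Y ∷ X≢Z ∷ []) ∷ (W≢Y ∷ W≢Z ∷ []) ∷ _ | ¬XY | ¬WZ =
  reaches-move {G' = H} (inj₂ (_ , _ , _ , _ , _ , VX , XW , WV , YZ
      , ≡.≢-sym V≢Y , ≡.≢-sym X≢Y , ≡.≢-sym W≢Y , ≡.≢-sym V≢Z , ≡.≢-sym X≢Z , ≡.≢-sym W≢Z
      , ¬XY , ¬WZ , λ _ _ → refl))
    same (run next res (closed-unchanged G H same cl)
      -- For a break the removed pairs are the triangle edge `xw` and the outer edge `yz`.
      (embed-switch em x< w< y< z< X≢Y X≢Z W≢Y W≢Z XW YZ ¬XY ¬WZ))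
  where
  H = switchPlaces em x< w< y< z< X≢Y X≢Z W≢Y W≢Z XW YZ ¬XY ¬WZ
  same : Unchanged G H _
  same = switch-unchanged em x< w< y< z< X≢Y X≢Z W≢Y W≢Z XW YZ ¬XY ¬WZ

-- Growing a triangle, a diamond and a K₄.

vertex triangle diamond k₄ : State
vertex = state 1 [] []
triangle = state 3 ((0 , 1) ∷ (1 , 2) ∷ (0 , 2) ∷ []) []
diamond = state 4 ((0 , 1) ∷ (0 , 2) ∷ (1 , 2) ∷ (1 , 3) ∷ (2 , 3) ∷ []) []
k₄ = state 4 ((0 , 1) ∷ (0 , 2) ∷ (0 , 3) ∷ (1 , 2) ∷ (1 , 3) ∷ (2 , 3) ∷ []) []

-- A make along a path `y x v w z` closes the triangle `x v w`. If `x` and `w` are adjacent the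
-- triangle is already there, so the search is for a path with non-adjacent ends.
vertex⇒triangle : Leads vertex triangle
vertex⇒triangle =
  nbr 0 []
    (nbr 0 []
      (nbr 0 []
        (nbr 1
          (done (0 ∷ 1 ∷ 2 ∷ []) ∷
           done (0 ∷ 1 ∷ 3 ∷ []) ∷ [])
          (split 2 4
            (split 1 3
              (done (0 ∷ 1 ∷ 3 ∷ []))
              (make 3 0 2 4 1
               (done (0 ∷ 2 ∷ 4 ∷ []))))
            (nbr 4
              ((split 1 2
                 (done (0 ∷ 1 ∷ 2 ∷ []))
                 (make 2 0 3 4 1
                  (done (0 ∷ 3 ∷ 4 ∷ [])))) ∷ [])
              -- The path 3, 0, 1, 4, 5 serves unless its ends are adjacent; the resulting 5-cycle
              -- then offers the path 2, 0, 3, 5, 4.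
              (split 3 5
                (make 2 0 3 5 4
                 (done (0 ∷ 3 ∷ 5 ∷ [])))
                (make 3 0 1 4 5
                 (done (0 ∷ 1 ∷ 4 ∷ [])))))))))

-- An outside neighbour shared by two triangle vertices gives a diamond at once. Otherwise the
-- outside neighbours 3, 4, 5 are distinct: if some but not all pairs of them are adjacent, one make
-- suffices; if none are, two makes; if all are, there is a prism.
triangle⇒diamond : Leads triangle diamond
triangle⇒diamond =
  nbr 0 []
    (nbr 1
      (done (2 ∷ 0 ∷ 1 ∷ 3 ∷ []) ∷ [])
      (nbr 2
        (done (1 ∷ 0 ∷ 2 ∷ 3 ∷ []) ∷
         done (0 ∷ 1 ∷ 2 ∷ 4 ∷ []) ∷ [])
        (split 3 4
          (split 3 5
            (split 4 5
              -- The six vertices form a prism.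
              (fresh
               (nbr 6 []
                 -- The break gives 1 the neighbour 6 in place of 2. The make can then trade 6 for
                 -- 3, and 1 and 3 have the common neighbours 0 and 4.
                 (break 0 1 2 6 7
                  (make 6 1 0 3 5
                   (done (0 ∷ 1 ∷ 3 ∷ 4 ∷ []))))))
              (make 4 1 0 3 5
               (done (2 ∷ 0 ∷ 1 ∷ 3 ∷ []))))
            (make 5 2 1 4 3
             (done (0 ∷ 1 ∷ 2 ∷ 4 ∷ []))))
          (split 3 5
            (make 4 1 2 5 3
             (done (0 ∷ 1 ∷ 2 ∷ 5 ∷ [])))
            (split 4 5
              (make 3 0 1 4 5
               (done (2 ∷ 0 ∷ 1 ∷ 4 ∷ [])))
              (nbr 3 []
                -- The first make trades the edge from 1 to 2 for one from 1 to 3; the second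
                -- restores the lost edge.
                (make 2 1 0 3 6
                 (make 4 1 0 2 5
                  (done (2 ∷ 0 ∷ 1 ∷ 3 ∷ []))))))))))

-- The vertices 0 and 3 each miss one neighbour. If their outside neighbours are distinct and
-- non-adjacent, one make joins 0 to 3; otherwise a preliminary make arranges this.
diamond⇒k₄ : Leads diamond k₄
diamond⇒k₄ =
  nbr 0
    (done (0 ∷ 1 ∷ 2 ∷ 3 ∷ []) ∷ [])
    (nbr 3
      ((nbr 4 []
         (nbr 5 []
           (nbr 6 []
             -- The common outside neighbour 4 of 0 and 3 is replaced at 3 by 7.
             (make 3 4 5 6 7
              (make 4 0 1 3 7
               (done (0 ∷ 1 ∷ 2 ∷ 3 ∷ []))))))) ∷ [])
      (split 4 5
        (nbr 4 []
          (nbr 5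
            ((nbr 6 []
               (nbr 7 []
                 -- In the triangle 4, 5, 6 the make removes the edge between 4 and 5.
                 (make 4 5 6 7 8
                  (make 4 0 1 3 5
                   (done (0 ∷ 1 ∷ 2 ∷ 3 ∷ [])))))) ∷ [])
            (nbr 6
              -- Here 3 trades its neighbour 5 for a neighbour of 6 that is not adjacent to 4.
              ((make 3 5 4 6 7
                (make 4 0 1 3 7
                 (done (0 ∷ 1 ∷ 2 ∷ 3 ∷ [])))) ∷ [])
              (make 3 5 4 6 8
               (make 4 0 1 3 8
                (done (0 ∷ 1 ∷ 2 ∷ 3 ∷ [])))))))
        (make 4 0 1 3 5
         (done (0 ∷ 1 ∷ 2 ∷ 3 ∷ [])))))

vertex⇒k₄ : Leads vertex k₄
vertex⇒k₄ = leads-trans vertex⇒triangle (leads-trans triangle⇒diamond diamond⇒k₄)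

-- Exhausting the graph by K₄ components.

record Clique₄ {n : ℕ} (G : Cubic n) (L : List (Fin n)) (u : Fin n) : Set where
  field
    members : Vec (Fin n) 4
    unique : Unique (toList members)
    contains : u ∈ toList members
    within : toList members ⊆ L
    adjacent : ∀ v w → v ∈ toList members → w ∈ toList members → v ≢ w → Edge G v w

length-toList₄ : {A : Set} (xs : Vec A 4) → length (toList xs) ≡ 4
length-toList₄ (_ ∷ _ ∷ _ ∷ _ ∷ []) = refl

module _ {n : ℕ} {G : Cubic n} {L : List (Fin n)} where

  -- A neighbour outside would make five distinct vertices among a and its three neighbours.
  clique-closed : ∀ {u a b} (S : Clique₄ G L u) → let open Clique₄ S in
    a ∈ toList members → Edge G a b → b ∈ toList members
  clique-closed {u} {a} {b} S a∈ ab = decidable-stable (b ∈? toList members) λ b∉ →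
    ℕ.<⇒≱ (subst (_< suc (length (toList members))) (length-toList₄ members) ℕ.≤-refl)
      (subst (suc (length (toList members)) ≤_) (cong suc (three-nbrs G a))
        (unique-⊆⇒length≤ (∉-cons b∉ unique) around))
    where
    open Clique₄ S
    around : b ∷ toList members ⊆ a ∷ nbrsOf (adj G a)
    around (here refl) = there (∈-nbrsOf ab)
    around {v} (there v∈) with v Fin.≟ a
    ... | yes v≡a = here v≡a
    ... | no v≢a = there (∈-nbrsOf (adjacent a v a∈ v∈ (v≢a ∘ ≡.sym)))

  cliques-closed : (∀ {u} → u ∈ L → Clique₄ G L u) → Closed G L
  cliques-closed cliques a∈ ab = Clique₄.within S (clique-closed S (Clique₄.contains S) ab)
    where S = cliques a∈

  cliques⇒K4Union : (∀ u → Clique₄ G L u) → K4Union G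
  cliques⇒K4Union cliques u = members , unique , component , adjacent
    where
    open Clique₄ (cliques u)

    reach : ∀ {v w} → v ∈ toList members → Connected G v w → w ∈ toList members
    reach v∈ ε = v∈
    reach v∈ (e ◅ es) = reach (clique-closed (cliques u) v∈ e) es

    connect : ∀ {v} → v ∈ toList members → Connected G u v
    connect {v} v∈ with u Fin.≟ v
    ... | yes refl = ε
    ... | no u≢v = adjacent u v contains v∈ u≢v ◅ ε

    component : ∀ v → Connected G u v ⇔ v ∈ toList members
    component v = mk⇔ (reach contains) connect

k₄-complete : ∀ {i} → i < 4 → ∀ {j} → j < 4 → i ≡ j ⊎ KnownAdjacent k₄ i j
k₄-complete = toWitness {a? = ℕ.allUpTo? (λ i → ℕ.allUpTo? (λ j →
  (i ℕ.≟ j) ⊎-dec knownAdjacent? k₄ i j) 4) 4} _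

module _ {n : ℕ} {G : Cubic n} {L : List (Fin n)} (em : Embedding G L k₄) where

  open Embedding em

  embedded-clique : ∀ {u} → u ∈ map place (upTo 4) → Clique₄ G (map place (upTo 4) ++ L) u
  embedded-clique u∈ = record
    { members = place 0 ∷ place 1 ∷ place 2 ∷ place 3 ∷ []
    ; unique = place-unique em (All.tabulate ∈-upTo⁻) (Unique.upTo⁺ 4)
    ; contains = u∈
    ; within = ∈-++⁺ˡ
    ; adjacent = adjacent
    }
    where
    adjacent : ∀ v w → v ∈ map place (upTo 4) → w ∈ map place (upTo 4) → v ≢ w → Edge G v w
    adjacent v w v∈ w∈ v≢w with ∈-map⁻ place v∈ | ∈-map⁻ place w∈
    ... | i , i∈ , refl | j , j∈ , refl with k₄-complete (∈-upTo⁻ i∈) (∈-upTo⁻ j∈)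
    ...   | inj₁ refl = contradiction refl v≢w
    ...   | inj₂ known = proj₂ (proj₂ (known-edge em known))

-- The field `within` places the clique in `L`, where adjacency does not change.
clique-unchanged : {n : ℕ} {G G' : Cubic n} {L : List (Fin n)} (M : List (Fin n)) {u : Fin n} →
  Unchanged G G' L → Clique₄ G L u → Clique₄ G' (M ++ L) u
clique-unchanged M same S = record
  { members = members
  ; unique = unique
  ; contains = contains
  ; within = ∈-++⁺ʳ M ∘ within
  ; adjacent = λ v w v∈ w∈ v≢w → trans (same (within v∈)) (adjacent v w v∈ w∈ v≢w)
  }
  where open Clique₄ S

-- Each round adds four vertices to `L` at the cost of one unit of fuel, so the bound on `n`
-- persists.
cliques-exhaust : (fuel : ℕ) {n : ℕ} (G : Cubic n) (L : List (Fin n)) → n ≤ fuel + length L →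
  Reserved L → (∀ {u} → u ∈ L → Clique₄ G L u) →
  Σ (Cubic n) λ H → K4Union H × Star Adjacent* G H
cliques-exhaust fuel {n} G L n≤ res cliques with Fin.any? (λ u → ¬? (u ∈? L))
... | no none = G , cliques⇒K4Union (λ u → cliques (decidable-stable (u ∈? L) (λ u∉ → none (u , u∉)))) , ε
cliques-exhaust zero G L n≤ res cliques | yes (u , u∉) =
  -- Without fuel `L` has at least `n` vertices, and `u` would be one too many.
  contradiction n≤ (ℕ.<⇒≱ (unique-length≤ (∉-cons u∉ (Reserved.unique res))))
cliques-exhaust (suc fuel) {n} G L n≤ res cliques | yes (u , u∉) = continue
  (run vertex⇒k₄ res (cliques-closed cliques)
    -- The state `vertex` has the single name 0, so a constant `place` will do.
    (embedding (λ _ → u) (λ i< j< _ → trans (ℕ.n<1⇒n≡0 i<) (≡.sym (ℕ.n<1⇒n≡0 j<))) (λ _ → u∉) [] []))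
  where
  continue : Reaches G L k₄ → Σ (Cubic n) λ H → K4Union H × Star Adjacent* G H
  continue (G' , path , same , em) with cliques-exhaust fuel G' (new ++ L) n≤' res' cliques'
    where
    new : List (Fin n)
    new = map (Embedding.place em) (upTo 4)

    n≤' : n ≤ fuel + (4 + length L)
    n≤' = ℕ.≤-trans n≤ (ℕ.≤-trans (ℕ.≤-reflexive (≡.sym (ℕ.+-suc fuel (length L))))
      -- One of the four new vertices makes up for the fuel spent; the other 3 are slack.
      (ℕ.+-monoʳ-≤ fuel (ℕ.m≤n+m (suc (length L)) 3)))

    res' : Reserved (new ++ L)
    res' = record
      { n%4 = Reserved.n%4 res
      ; unique = places-unique em (Reserved.unique res)
      ; length%4 = trans (%-distribˡ-+ 4 (length L) 4) (cong (_% 4) (Reserved.length%4 res))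
      }

    cliques' : ∀ {v} → v ∈ new ++ L → Clique₄ G' (new ++ L) v
    cliques' v∈ with ∈-++⁻ new v∈
    ... | inj₁ v∈new = embedded-clique em v∈new
    ... | inj₂ v∈L = clique-unchanged {G = G} new same (cliques v∈L)
  ... | H , union , path' = H , union , path ◅◅ path'

theorem4 : (n : ℕ) → n % 4 ≡ 0 → (G : Cubic n) →
    Σ (Cubic n) λ H → K4Union H × Star Adjacent* G H
theorem4 n n%4 G = cliques-exhaust n G [] (ℕ.m≤m+n n 0)
  (record { n%4 = n%4 ; unique = [] ; length%4 = refl }) λ ()
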